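{- Let $n,r$ be integers with $1\le r<n/2$, let $\delta$ be a real number with $\delta<\frac{1}{2rn^4}$, and let $G$ be an intersecting $r$-graph on $n$ vertices with $|G|>(1-\delta)\binom{n-1}{r-1}$. Then there is a vertex $v$ of $G$ such that all but at most $\delta r\binom{n-1}{r-1}$ edges of $G$ contain $v$.
   Context: An $r$-graph $G$ consists of a finite vertex set $V(G)$ and a set $E(G)$ of edges, each edge being an $r$-element subset of $V(G)$; $|G|=|E(G)|$. An $r$-graph is intersecting if every two of its edges have at least one common vertex. -}

module Defs where

open import Data.Nat.Base as ℕ using (ℕ; NonZero)
import Data.Nat.Properties as ℕ
open import Data.Integer.Base using (+_)
open import Data.Rational.Base
  using (ℚ; _+_; _-_; _*_; _≤_; _<_; ∣_∣; 0ℚ; 1ℚ; _/_; 1/_; Positive; positive)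
open import Data.Rational.Properties as ℚ
open import Data.Fin.Base using (Fin)
open import Data.Fin.Subset as Subset using (Subset; Nonempty; _∩_)
open import Data.Fin.Subset.Properties using (_∈?_)
open import Data.List.Base using (List; length; filter)
open import Data.List.Membership.Propositional using (_∈_)
open import Data.List.Relation.Unary.All using (All)
open import Data.List.Relation.Unary.Unique.Propositional using (Unique)
open import Data.Product.Base using (∃-syntax; _×_; _,_)
open import Relation.Nullary.Decidable using (¬?; dec⇒maybe)
open import Relation.Binary.PropositionalEquality
open import Tactic.RingSolver using (solve-∀)
open import Tactic.RingSolver.Core.AlmostCommutativeRing using (fromCommutativeRing)

-- Real numbers as Cauchy sequences of rationals. Equality of reals is
-- x ≤ᴿ y × y ≤ᴿ x, not _≡_.

IsCauchy : (ℕ → ℚ) → Set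
IsCauchy x = ∀ ε → 0ℚ < ε → ∃[ N ] (∀ m n → N ℕ.≤ m → N ℕ.≤ n → ∣ x m - x n ∣ < ε)

record ℝ : Set where
  constructor real
  field
    seq    : ℕ → ℚ
    cauchy : IsCauchy seq

open ℝ public

infix  4 _<ᴿ_ _≤ᴿ_ _>ᴿ_
infixl 6 _-ᴿ_
infixl 7 _*ᴿ_

_<ᴿ_ : ℝ → ℝ → Set
x <ᴿ y = ∃[ ε ] (0ℚ < ε × ∃[ N ] (∀ n → N ℕ.≤ n → seq x n + ε ≤ seq y n))

_>ᴿ_ : ℝ → ℝ → Set
x >ᴿ y = y <ᴿ x

_≤ᴿ_ : ℝ → ℝ → Set
x ≤ᴿ y = ∀ ε → 0ℚ < ε → ∃[ N ] (∀ n → N ℕ.≤ n → seq x n ≤ seq y n + ε)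

fromℚ : ℚ → ℝ
fromℚ q = real (λ _ → q) λ ε 0<ε →
  0 , λ _ _ _ _ → subst (λ d → ∣ d ∣ < ε) (sym (+-inverseʳ q)) 0<ε

fromℕ : ℕ → ℝ
fromℕ k = fromℚ (+ k / 1)

private
  open ℚ.≤-Reasoning

  ring = fromCommutativeRing +-*-commutativeRing (λ p → dec⇒maybe (0ℚ ℚ.≟ p))

  telescope₁ : ∀ p q → p ≡ p - q + q
  telescope₁ = solve-∀ ring

  telescope₂ : ∀ p q r s → (p - q) - (r - s) ≡ (p - r) - (q - s)
  telescope₂ = solve-∀ ring

  telescope₃ : ∀ p q r s → p * q - r * s ≡ p * (q - s) + s * (p - r)
  telescope₃ = solve-∀ ring

  split : ∀ b ε → 0ℚ < b → 0ℚ < ε → ∃[ η ] (0ℚ < η × b * η + b * η ≡ ε)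
  split b ε 0<b 0<ε = η , positive⁻¹ η , eq
    where
    instance
      b⁺ : Positive b
      b⁺ = positive 0<b
      ε⁺ : Positive ε
      ε⁺ = positive 0<ε
      2b⁺ : Positive (b + b)
      2b⁺ = pos+pos⇒pos b b
      2b≢0 = pos⇒nonZero (b + b)
      inv⁺ : Positive (1/ (b + b))
      inv⁺ = 1/pos⇒pos (b + b)
    η : ℚ
    η = 1/ (b + b) * ε
    instance
      η⁺ : Positive η
      η⁺ = pos*pos⇒pos (1/ (b + b)) ε
    eq : b * η + b * η ≡ ε
    eq = trans (sym (*-distribʳ-+ η b b))
        (trans (sym (*-assoc (b + b) (1/ (b + b)) ε))
        (trans (cong (_* ε) (*-inverseʳ (b + b))) (*-identityˡ ε)))

  eventuallyBounded : ∀ x → IsCauchy x →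
    ∃[ b ] (0ℚ < b × ∃[ N ] (∀ n → N ℕ.≤ n → ∣ x n ∣ ≤ b))
  eventuallyBounded x cx with cx 1ℚ (positive⁻¹ 1ℚ)
  ... | N , close = 1ℚ + ∣ x N ∣ , 0<b , N , bound
    where
    0<b : 0ℚ < 1ℚ + ∣ x N ∣
    0<b = +-mono-<-≤ (positive⁻¹ 1ℚ) (0≤∣p∣ (x N))
    bound : ∀ n → N ℕ.≤ n → ∣ x n ∣ ≤ 1ℚ + ∣ x N ∣
    bound n N≤n = begin
      ∣ x n ∣                    ≡⟨ cong ∣_∣ (telescope₁ (x n) (x N)) ⟩
      ∣ x n - x N + x N ∣        ≤⟨ ∣p+q∣≤∣p∣+∣q∣ (x n - x N) (x N) ⟩
      ∣ x n - x N ∣ + ∣ x N ∣    ≤⟨ +-monoˡ-≤ ∣ x N ∣ (<⇒≤ (close n N N≤n ℕ.≤-refl)) ⟩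
      1ℚ + ∣ x N ∣               ∎

  ∣∣-mono-* : ∀ {p q b η} → 0ℚ < b → ∣ p ∣ ≤ b → ∣ q ∣ < η → ∣ p * q ∣ < b * η
  ∣∣-mono-* {p} {q} {b} {η} 0<b p≤b q<η = begin-strict
    ∣ p * q ∣      ≡⟨ ∣p*q∣≡∣p∣*∣q∣ p q ⟩
    ∣ p ∣ * ∣ q ∣  ≤⟨ *-monoʳ-≤-nonNeg ∣ q ∣ {{∣-∣-nonNeg q}} p≤b ⟩
    b * ∣ q ∣      <⟨ *-monoʳ-<-pos b {{positive 0<b}} q<η ⟩
    b * η          ∎

  sub-cauchy : ∀ x y → IsCauchy x → IsCauchy y → IsCauchy (λ n → x n - y n)
  sub-cauchy x y cx cy ε 0<ε with split 1ℚ ε (positive⁻¹ 1ℚ) 0<ε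
  ... | η , 0<η , eq with cx η 0<η | cy η 0<η
  ... | M , xclose | N , yclose = M ℕ.⊔ N , close
    where
    close : ∀ m n → M ℕ.⊔ N ℕ.≤ m → M ℕ.⊔ N ℕ.≤ n → ∣ (x m - y m) - (x n - y n) ∣ < ε
    close m n ≤m ≤n = begin-strict
      ∣ (x m - y m) - (x n - y n) ∣
        ≡⟨ cong ∣_∣ (telescope₂ (x m) (y m) (x n) (y n)) ⟩
      ∣ (x m - x n) - (y m - y n) ∣
        ≤⟨ ∣p-q∣≤∣p∣+∣q∣ (x m - x n) (y m - y n) ⟩
      ∣ x m - x n ∣ + ∣ y m - y n ∣
        <⟨ +-mono-< (xclose m n (ℕ.m⊔n≤o⇒m≤o M N ≤m) (ℕ.m⊔n≤o⇒m≤o M N ≤n))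
                    (yclose m n (ℕ.m⊔n≤o⇒n≤o M N ≤m) (ℕ.m⊔n≤o⇒n≤o M N ≤n)) ⟩
      η + η
        ≡⟨ cong₂ _+_ (*-identityˡ η) (*-identityˡ η) ⟨
      1ℚ * η + 1ℚ * η
        ≡⟨ eq ⟩
      ε ∎

  mul-close : ∀ p q r s b η → 0ℚ < b → ∣ p ∣ ≤ b → ∣ s ∣ ≤ b →
              ∣ p - r ∣ < η → ∣ q - s ∣ < η → ∣ p * q - r * s ∣ < b * η + b * η
  mul-close p q r s b η 0<b p≤b s≤b p-r<η q-s<η = begin-strict
    ∣ p * q - r * s ∣                      ≡⟨ cong ∣_∣ (telescope₃ p q r s) ⟩
    ∣ p * (q - s) + s * (p - r) ∣          ≤⟨ ∣p+q∣≤∣p∣+∣q∣ (p * (q - s)) (s * (p - r)) ⟩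
    ∣ p * (q - s) ∣ + ∣ s * (p - r) ∣      <⟨ +-mono-< {∣ p * (q - s) ∣} {b * η} {∣ s * (p - r) ∣} {b * η}
                                                (∣∣-mono-* {p} {q - s} 0<b p≤b q-s<η)
                                                (∣∣-mono-* {s} {p - r} 0<b s≤b p-r<η) ⟩
    b * η + b * η                          ∎

  mul-cauchy : ∀ x y → IsCauchy x → IsCauchy y → IsCauchy (λ n → x n * y n)
  mul-cauchy x y cx cy ε 0<ε =
    let b , 0<b , K , xb = eventuallyBounded x cx
        c , 0<c , L , yc = eventuallyBounded y cy
        b≤b+c = subst (_≤ b + c) (+-identityʳ b) (+-monoʳ-≤ b (<⇒≤ 0<c))
        c≤b+c = subst (_≤ b + c) (+-identityˡ c) (+-monoˡ-≤ c (<⇒≤ 0<b))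
    in go (b + c) K L (<-≤-trans 0<b b≤b+c)
          (λ n K≤n → ≤-trans (xb n K≤n) b≤b+c)
          (λ n L≤n → ≤-trans (yc n L≤n) c≤b+c)
    where
    go : ∀ b K L → 0ℚ < b →
         (∀ n → K ℕ.≤ n → ∣ x n ∣ ≤ b) → (∀ n → L ℕ.≤ n → ∣ y n ∣ ≤ b) →
         ∃[ N ] (∀ m n → N ℕ.≤ m → N ℕ.≤ n → ∣ x m * y m - x n * y n ∣ < ε)
    go b K L 0<b xb yb =
      let η , 0<η , eq = split b ε 0<b 0<ε
          M , xclose   = cx η 0<η
          N , yclose   = cy η 0<η
      in (K ℕ.⊔ L) ℕ.⊔ (M ℕ.⊔ N) , λ m n ≤m ≤n →
           let KL≤m = ℕ.m⊔n≤o⇒m≤o (K ℕ.⊔ L) (M ℕ.⊔ N) ≤m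
               MN≤m = ℕ.m⊔n≤o⇒n≤o (K ℕ.⊔ L) (M ℕ.⊔ N) ≤m
               KL≤n = ℕ.m⊔n≤o⇒m≤o (K ℕ.⊔ L) (M ℕ.⊔ N) ≤n
               MN≤n = ℕ.m⊔n≤o⇒n≤o (K ℕ.⊔ L) (M ℕ.⊔ N) ≤n
           in subst (∣ x m * y m - x n * y n ∣ <_) eq
                (mul-close (x m) (y m) (x n) (y n) b η 0<b
                  (xb m (ℕ.m⊔n≤o⇒m≤o K L KL≤m)) (yb n (ℕ.m⊔n≤o⇒n≤o K L KL≤n))
                  (xclose m n (ℕ.m⊔n≤o⇒m≤o M N MN≤m) (ℕ.m⊔n≤o⇒m≤o M N MN≤n))
                  (yclose m n (ℕ.m⊔n≤o⇒n≤o M N MN≤m) (ℕ.m⊔n≤o⇒n≤o M N MN≤n)))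

_-ᴿ_ : ℝ → ℝ → ℝ
x -ᴿ y = real (λ n → seq x n - seq y n) (sub-cauchy (seq x) (seq y) (cauchy x) (cauchy y))

_*ᴿ_ : ℝ → ℝ → ℝ
x *ᴿ y = real (λ n → seq x n * seq y n) (mul-cauchy (seq x) (seq y) (cauchy x) (cauchy y))

-- An r-graph with vertex set Fin n. The list only enumerates the edge set;
-- `distinct` makes its length the number of edges.
record Hypergraph (r n : ℕ) : Set where
  field
    edges    : List (Subset n)
    distinct : Unique edges
    uniform  : All (λ e → Subset.∣ e ∣ ≡ r) edges

open Hypergraph public

size : ∀ {r n} → Hypergraph r n → ℕ
size G = length (edges G)

-- The case e ≡ f says only that edges are nonempty, which is automatic for r ≥ 1.
Intersecting : ∀ {r n} → Hypergraph r n → Set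
Intersecting G = ∀ {e f} → e ∈ edges G → f ∈ edges G → Nonempty (e ∩ f)

edgesAvoiding : ∀ {r n} → Hypergraph r n → Fin n → List (Subset n)
edgesAvoiding G v = filter (λ e → ¬? (v ∈? e)) (edges G)

2rn⁴≢0 : ∀ {r n} → 1 ℕ.≤ r → 2 ℕ.* r ℕ.< n → NonZero (2 ℕ.* r ℕ.* n ℕ.^ 4)
2rn⁴≢0 {r} {n} 1≤r 2r<n = ℕ.m*n≢0 (2 ℕ.* r) (n ℕ.^ 4) {{2r≢0}} {{n⁴≢0}}
  where
  2r≢0 : NonZero (2 ℕ.* r)
  2r≢0 = ℕ.m*n≢0 2 r {{_}} {{ℕ.>-nonZero 1≤r}}
  n⁴≢0 : NonZero (n ℕ.^ 4)
  n⁴≢0 = ℕ.m^n≢0 n 4 {{ℕ.>-nonZero (ℕ.m<n⇒0<n 2r<n)}}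

{-# OPTIONS --safe #-}
-- For a vertex w let A be the family of edges avoiding w and D the family of (r - 1)-sets of
-- other vertices which do not extend by w to an edge. Since G is intersecting, D contains the
-- (r - 1)-shadow of the complements of the members of A, and counting gives
-- |G| + |D| = |A| + M with M = (n - 1) C (r - 1). So lower bounds on shadows bound |A| by the
-- deficiency m = M - |G|.
--
-- The shadow bound is Lovász's form of the Kruskal–Katona theorem at integer arguments,
-- proved by Keevash's induction: either all links are small and one averages over them, or
-- one link is large and its own shadows at two levels already suffice. The same induction
-- shows that a family smaller by a factor 1 - (s + 1)/K than the extremal one has an s-shadow
-- larger by a factor 1 + 1/K than the Lovász bound. Applied with K = rn to a vertex w of at least
-- average degree this gives |A| ≤ rnm. Hence A is so small that the Lovász bound applies
-- with one vertex fewer, and this improves the estimate to |A| ≤ (r - 1)m.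
module Submission where

open import Defs
import Data.Nat.Base as ℕ
import Data.Nat.Properties as ℕ
open import Data.Nat.Base using (ℕ)
open import Data.Integer.Base using (+_)
open import Relation.Binary.PropositionalEquality

-- Passing between rational and integer inequalities

module RationalBounds where
  import Data.Integer.Base as ℤ
  import Data.Integer.Properties as ℤ
  open import Data.Rational.Base
  open import Data.Rational.Properties
  import Data.Rational.Unnormalised.Base as ℚᵘ
  import Data.Rational.Unnormalised.Properties as ℚᵘ
  open import Relation.Nullary.Decidable using (dec⇒maybe)
  open import Tactic.RingSolver using (solve-∀)
  open import Tactic.RingSolver.Core.AlmostCommutativeRing using (fromCommutativeRing)

  ι : ℕ → ℚ
  ι k = + k / 1

  ιᵘ : ℕ → ℚᵘ.ℚᵘ
  ιᵘ k = ℚᵘ.mkℚᵘ (+ k) 0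

  toℚᵘ-ι : ∀ k → toℚᵘ (ι k) ℚᵘ.≃ ιᵘ k
  toℚᵘ-ι k = toℚᵘ-fromℚᵘ (ιᵘ k)

  ι-+ : ∀ a b → ι (a ℕ.+ b) ≡ ι a + ι b
  ι-+ a b = toℚᵘ-injective (begin-equality
    toℚᵘ (ι (a ℕ.+ b))             ≃⟨ toℚᵘ-ι (a ℕ.+ b) ⟩
    ιᵘ (a ℕ.+ b)
      ≃⟨ ℚᵘ.*≡* (cong (ℤ._* + 1) (sym (cong₂ ℤ._+_ (ℤ.*-identityʳ (+ a)) (ℤ.*-identityʳ (+ b))))) ⟩
    ιᵘ a ℚᵘ.+ ιᵘ b                 ≃⟨ ℚᵘ.+-cong (toℚᵘ-ι a) (toℚᵘ-ι b) ⟨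
    toℚᵘ (ι a) ℚᵘ.+ toℚᵘ (ι b)     ≃⟨ toℚᵘ-homo-+ (ι a) (ι b) ⟨
    toℚᵘ (ι a + ι b)               ∎)
    where open ℚᵘ.≤-Reasoning

  ι-* : ∀ a b → ι (a ℕ.* b) ≡ ι a * ι b
  ι-* a b = toℚᵘ-injective (begin-equality
    toℚᵘ (ι (a ℕ.* b))             ≃⟨ toℚᵘ-ι (a ℕ.* b) ⟩
    ιᵘ (a ℕ.* b)                   ≃⟨ ℚᵘ.*≡* (cong (ℤ._* + 1) (ℤ.pos-* a b)) ⟩
    ιᵘ a ℚᵘ.* ιᵘ b                 ≃⟨ ℚᵘ.*-cong (toℚᵘ-ι a) (toℚᵘ-ι b) ⟨
    toℚᵘ (ι a) ℚᵘ.* toℚᵘ (ι b)     ≃⟨ toℚᵘ-homo-* (ι a) (ι b) ⟨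
    toℚᵘ (ι a * ι b)               ∎)
    where open ℚᵘ.≤-Reasoning

  ι-mono-≤ : ∀ {a b} → a ℕ.≤ b → ι a ≤ ι b
  ι-mono-≤ {a} {b} a≤b = toℚᵘ-cancel-≤ (begin
    toℚᵘ (ι a)    ≃⟨ toℚᵘ-ι a ⟩
    ιᵘ a          ≤⟨ ℚᵘ.*≤* (ℤ.*-monoʳ-≤-nonNeg (+ 1) (ℤ.+≤+ a≤b)) ⟩
    ιᵘ b          ≃⟨ toℚᵘ-ι b ⟨
    toℚᵘ (ι b)    ∎)
    where open ℚᵘ.≤-Reasoning

  ι-cancel-≤ : ∀ {a b} → ι a ≤ ι b → a ℕ.≤ b
  ι-cancel-≤ {a} {b} ιa≤ιb = ℤ.drop‿+≤+
    (subst₂ ℤ._≤_ (ℤ.*-identityʳ (+ a)) (ℤ.*-identityʳ (+ b)) (ℚᵘ.drop-*≤* (begin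
    ιᵘ a          ≃⟨ toℚᵘ-ι a ⟨
    toℚᵘ (ι a)    ≤⟨ toℚᵘ-mono-≤ ιa≤ιb ⟩
    toℚᵘ (ι b)    ≃⟨ toℚᵘ-ι b ⟩
    ιᵘ b          ∎)))
    where open ℚᵘ.≤-Reasoning

  ι-nonNeg : ∀ k → NonNegative (ι k)
  ι-nonNeg k = normalize-nonNeg k 1

  ι*1/ : ∀ k .{{_ : ℕ.NonZero k}} → ι k * (+ 1 / k) ≡ 1ℚ
  ι*1/ k@(ℕ.suc k-1) = toℚᵘ-injective (begin-equality
    toℚᵘ (ι k * (+ 1 / k))                 ≃⟨ toℚᵘ-homo-* (ι k) (+ 1 / k) ⟩
    toℚᵘ (ι k) ℚᵘ.* toℚᵘ (+ 1 / k)         ≃⟨ ℚᵘ.*-cong (toℚᵘ-ι k) (toℚᵘ-fromℚᵘ (ℚᵘ.mkℚᵘ (+ 1) k-1)) ⟩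
    ιᵘ k ℚᵘ.* ℚᵘ.mkℚᵘ (+ 1) k-1
      ≃⟨ ℚᵘ.*≡* (trans (ℤ.*-identityʳ _) (trans (ℤ.*-identityʳ (+ k))
                 (sym (trans (ℤ.*-identityˡ _) (cong +_ (ℕ.*-identityˡ k)))))) ⟩
    ℚᵘ.1ℚᵘ                                 ∎)
    where open ℚᵘ.≤-Reasoning

  private
    ring = fromCommutativeRing +-*-commutativeRing (λ p → dec⇒maybe (0ℚ ≟ p))

  p≤p+ε : ∀ p {ε} → 0ℚ < ε → p ≤ p + ε
  p≤p+ε p {ε} 0<ε = subst (_≤ p + ε) (+-identityʳ p) (+-monoʳ-≤ p (<⇒≤ 0<ε))

  -- Replacing `x` by 1/Q and clearing the denominator leaves a statement about integers. All
  -- combinatorics can thus be done in `ℕ`, with `δ` seen only through one rational term `x` of its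
  -- sequence.
  near-maximum : ∀ Q .{{_ : ℕ.NonZero Q}} M z x →
    x ≤ + 1 / Q → (1ℚ - x) * ι M ≤ ι z → Q ℕ.* M ℕ.≤ Q ℕ.* z ℕ.+ M
  near-maximum Q M z x x≤1/Q near = ι-cancel-≤ (begin
    ι (Q ℕ.* M)                                ≡⟨ ι-* Q M ⟩
    ι Q * ι M                                  ≡⟨ split (ι Q) x (ι M) ⟩
    ι Q * ((1ℚ - x) * ι M) + ι Q * x * ι M
      ≤⟨ +-mono-≤ (*-monoˡ-≤-nonNeg (ι Q) near)
                  (*-monoʳ-≤-nonNeg (ι M) (*-monoˡ-≤-nonNeg (ι Q) x≤1/Q)) ⟩
    ι Q * ι z + ι Q * (+ 1 / Q) * ι M          ≡⟨ cong (λ q → ι Q * ι z + q * ι M) (ι*1/ Q) ⟩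
    ι Q * ι z + 1ℚ * ι M                       ≡⟨ cong₂ _+_ (sym (ι-* Q z)) (*-identityˡ (ι M)) ⟩
    ι (Q ℕ.* z) + ι M                          ≡⟨ ι-+ (Q ℕ.* z) M ⟨
    ι (Q ℕ.* z ℕ.+ M)                          ∎)
    where
    open ≤-Reasoning
    instance
      Q≥0 = ι-nonNeg Q
      M≥0 = ι-nonNeg M
    split : ∀ q x m → q * m ≡ q * ((1ℚ - x) * m) + q * x * m
    split = solve-∀ ring

  -- The first hypothesis is a ≤ r (M - z) without subtraction, and the second gives M - z ≤ x M.
  avoiding-bound : ∀ r M z a x →
    a ℕ.+ r ℕ.* z ℕ.≤ r ℕ.* M → (1ℚ - x) * ι M ≤ ι z → ι a ≤ x * ι r * ι M
  avoiding-bound r M z a x few near = begin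
    ι a                                            ≡⟨ cancel (ι a) (ι r * ((1ℚ - x) * ι M)) ⟩
    ι a + ι r * ((1ℚ - x) * ι M) - ι r * ((1ℚ - x) * ι M)
      ≤⟨ +-monoˡ-≤ (- (ι r * ((1ℚ - x) * ι M))) (+-monoʳ-≤ (ι a) (*-monoˡ-≤-nonNeg (ι r) near)) ⟩
    ι a + ι r * ι z - ι r * ((1ℚ - x) * ι M)
      ≤⟨ +-monoˡ-≤ (- (ι r * ((1ℚ - x) * ι M))) few′ ⟩
    ι r * ι M - ι r * ((1ℚ - x) * ι M)             ≡⟨ collect (ι r) x (ι M) ⟩
    x * ι r * ι M                                  ∎
    where
    open ≤-Reasoning
    instance
      r≥0 = ι-nonNeg r
    few′ : ι a + ι r * ι z ≤ ι r * ι M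
    few′ = subst₂ _≤_ (trans (ι-+ a (r ℕ.* z)) (cong (λ q → ι a + q) (ι-* r z))) (ι-* r M) (ι-mono-≤ few)
    cancel : ∀ p q → p ≡ p + q - q
    cancel = solve-∀ ring
    collect : ∀ r x m → r * m - r * ((1ℚ - x) * m) ≡ x * r * m
    collect = solve-∀ ring

open import Data.Nat.Base
  using (zero; suc; _+_; _*_; _^_; _∸_; _≤_; _<_; _≡ᵇ_; z≤n; s≤s; NonZero; >-nonZero)
open import Data.Nat.Properties
open import Data.Nat.Combinatorics
  using (_C_; nC1≡n; nCk≡nC[n∸k]; k>n⇒nCk≡0; nCk+nC[k+1]≡[n+1]C[k+1])
open import Data.Nat.Tactic.RingSolver using (solve-∀)
open import Algebra.Properties.CommutativeSemigroup +-commutativeSemigroup using (interchange)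
open import Algebra.Properties.CommutativeSemigroup *-commutativeSemigroup using (x∙yz≈y∙xz)
open import Algebra.Properties.Semiring.Sum +-*-semiring
  using (sum; *-distribˡ-sum; ∑-distrib-+; sum-cong-≗)
open import Data.Rational.Base using (_/_)
import Data.Rational.Properties as ℚ
open import Data.Bool.Base using (Bool; true; false; _∧_; not; if_then_else_)
import Data.Bool.Properties as Bool
open import Data.Fin.Base using (Fin; zero; suc)
open import Data.Fin.Properties using (all?; ¬∀⟶∃¬)
open import Data.Fin.Subset as Subset
  using (Subset; inside; outside; ∣_∣; _⊆_; ∁; Nonempty; _∩_) renaming (⊥ to ∅)
open import Data.Fin.Subset.Properties
  using (out⊆; in⊆in; drop-∷-⊆; ⊥⊆; ∣⊥∣≡0; ∣p∣≤n; ∣∁p∣≡n∸∣p∣; x∈p∩q⁻; x∈p⇒x∉∁p)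
  renaming (_∈?_ to _∈ₛ?_)
open import Data.Vec.Base as Vec using ([]; _∷_; insertAt)
open import Data.Vec.Properties using (map-insertAt; ≡-dec)
open import Data.List.Base using (List; []; _∷_; length)
open import Data.List.Membership.Propositional using (_∈_)
open import Data.List.Membership.Propositional.Properties using (∈-filter⁻)
import Data.List.Membership.DecPropositional as DecMembership
open import Data.List.Relation.Unary.Any using (here; there)
import Data.List.Relation.Unary.All as All
open import Data.List.Relation.Unary.AllPairs using ([]; _∷_)
open import Data.List.Relation.Unary.Unique.Propositional using (Unique)
import Data.List.Relation.Unary.Unique.Propositional.Properties as Unique
open import Data.Product.Base using (∃-syntax; _×_; _,_; proj₁; proj₂)
open import Data.Sum.Base using (_⊎_; inj₁; inj₂)
open import Data.Empty using (⊥-elim)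
open import Function.Base using (_∘_; id)
open import Function.Bundles using (Equivalence)
open import Relation.Nullary using (¬_; yes; no; does; contradiction)
open import Relation.Nullary.Decidable using (dec-true; ¬?)

private variable
  n k s t y : ℕ

-- Binomial coefficients

absorption : ∀ n k → suc k * (suc n C suc k) ≡ suc n * (n C k)
absorption zero    zero    = refl
absorption zero    (suc k) =
  trans (cong (suc (suc k) *_) (k>n⇒nCk≡0 (s≤s (s≤s (z≤n {k}))))) (*-zeroʳ (suc (suc k)))
absorption (suc n) zero    = trans (+-identityʳ _) (trans (nC1≡n (suc (suc n))) (sym (*-identityʳ _)))
absorption (suc n) (suc k) = begin
  suc (suc k) * (suc (suc n) C suc (suc k))
    ≡⟨ cong (suc (suc k) *_) (nCk+nC[k+1]≡[n+1]C[k+1] (suc n) (suc k)) ⟨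
  suc (suc k) * (p + q)
    ≡⟨ expand (suc k) p q ⟩
  suc k * p + suc (suc k) * q + p
    ≡⟨ cong₂ (λ a b → a + b + p) (absorption n k) (absorption n (suc k)) ⟩
  suc n * (n C k) + suc n * (n C suc k) + p
    ≡⟨ cong (_+ p) (*-distribˡ-+ (suc n) (n C k) (n C suc k)) ⟨
  suc n * (n C k + n C suc k) + p
    ≡⟨ cong (λ a → suc n * a + p) (nCk+nC[k+1]≡[n+1]C[k+1] n k) ⟩
  suc n * p + p
    ≡⟨ +-comm (suc n * p) p ⟩
  suc (suc n) * p ∎
  where
  open ≡-Reasoning
  p = suc n C suc k
  q = suc n C suc (suc k)
  expand : ∀ a p q → (1 + a) * (p + q) ≡ a * p + (1 + a) * q + p
  expand = solve-∀

C-sym : ∀ a b → (a + b) C a ≡ (a + b) C b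
C-sym a b = trans (nCk≡nC[n∸k] (m≤m+n a b)) (cong ((a + b) C_) (m+n∸m≡n a b))

C-pos : k ≤ n → 0 < n C k
C-pos {zero}          z≤n       = s≤s z≤n
C-pos {suc k} {suc n} (s≤s k≤n) =
  subst (0 <_) (nCk+nC[k+1]≡[n+1]C[k+1] n k) (≤-trans (C-pos k≤n) (m≤m+n _ _))

-- Finite sums, families of sets, links and degrees

sum-mono : ∀ {f g : Fin n → ℕ} → (∀ i → f i ≤ g i) → sum f ≤ sum g
sum-mono {zero}  f≤g = z≤n
sum-mono {suc n} f≤g = +-mono-≤ (f≤g zero) (sum-mono (f≤g ∘ suc))

exists≥average : ∀ (f : Fin (suc n) → ℕ) → ∃[ i ] sum f ≤ suc n * f i
exists≥average {zero}  f = zero , ≤-refl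
exists≥average {suc n} f with exists≥average (f ∘ suc)
... | i , avg with ≤-total (f zero) (f (suc i))
...   | inj₁ f0≤fi = suc i , +-mono-≤ f0≤fi avg
...   | inj₂ fi≤f0 = zero , +-monoʳ-≤ (f zero) (≤-trans avg (*-monoʳ-≤ (suc n) fi≤f0))

-- With characteristic functions the sections at a vertex, links and complements are all
-- compositions, and `card` is a recursion on the first vertex.
Family : ℕ → Set
Family n = Subset n → Bool

infix 4 _⊑_
_⊑_ : Family n → Family n → Set
F ⊑ H = ∀ e → F e ≡ true → H e ≡ true

Uniform : ℕ → Family n → Set
Uniform k F = ∀ e → F e ≡ true → ∣ e ∣ ≡ k

card : Family n → ℕ
card {zero}  F = if F [] then 1 else 0
card {suc n} F = card (F ∘ (inside ∷_)) + card (F ∘ (outside ∷_))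

card-mono : {F H : Family n} → F ⊑ H → card F ≤ card H
card-mono {zero} {F} {H} F⊑H with F [] in eq
... | false = z≤n
... | true rewrite F⊑H [] eq = ≤-refl
card-mono {suc n} F⊑H = +-mono-≤ (card-mono (F⊑H ∘ (inside ∷_))) (card-mono (F⊑H ∘ (outside ∷_)))

card≡0 : {F : Family n} → (∀ e → F e ≢ true) → card F ≡ 0
card≡0 {zero} {F} ∄ with F [] in eq
... | false = refl
... | true  = ⊥-elim (∄ [] eq)
card≡0 {suc n} ∄ = cong₂ _+_ (card≡0 (∄ ∘ (inside ∷_))) (card≡0 (∄ ∘ (outside ∷_)))

card-pos : {F : Family n} (e : Subset n) → F e ≡ true → 0 < card F
card-pos []            Fe rewrite Fe = s≤s z≤n
card-pos (inside  ∷ e) Fe = ≤-trans (card-pos e Fe) (m≤m+n _ _)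
card-pos (outside ∷ e) Fe = ≤-trans (card-pos e Fe) (m≤n+m _ _)

empty⊎inhabited : (F : Family n) → card F ≡ 0 ⊎ ∃[ e ] F e ≡ true
empty⊎inhabited {zero} F with F [] in eq
... | false = inj₁ refl
... | true  = inj₂ ([] , eq)
empty⊎inhabited {suc n} F with empty⊎inhabited (F ∘ (inside ∷_)) | empty⊎inhabited (F ∘ (outside ∷_))
... | inj₂ (e , Fe) | _             = inj₂ (inside ∷ e , Fe)
... | inj₁ _        | inj₂ (e , Fe) = inj₂ (outside ∷ e , Fe)
... | inj₁ p        | inj₁ q        = inj₁ (cong₂ _+_ p q)

cons : Family n → Family n → Family (suc n)
cons F H (inside  ∷ e) = F e
cons F H (outside ∷ e) = H e

subfamily : (F : Family n) → k ≤ card F → ∃[ F′ ] (F′ ⊑ F × card F′ ≡ k)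
subfamily {zero} {zero}  F _ = (λ _ → false) , (λ _ ()) , refl
subfamily {zero} {suc k} F k≤ with F [] in eq
subfamily {zero} {suc zero}    F k≤ | true = F , (λ _ Fe → Fe) , cong (if_then 1 else 0) eq
subfamily {zero} {suc (suc k)} F (s≤s ()) | true
subfamily {suc n} {k} F k≤ with k ≤? card (F ∘ (inside ∷_))
... | yes k≤in with subfamily (F ∘ (inside ∷_)) k≤in
...   | F′ , F′⊑ , refl = cons F′ (λ _ → false)
        , (λ { (inside ∷ e) → F′⊑ e ; (outside ∷ e) () })
        , trans (cong (λ z → card F′ + z) (card≡0 {n} (λ _ ()))) (+-identityʳ _)
subfamily {suc n} {k} F k≤ | no k≰in
  with subfamily (F ∘ (outside ∷_)) (m≤n+o⇒m∸n≤o k (card (F ∘ (inside ∷_))) k≤)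
...   | F′ , F′⊑ , eq = cons (F ∘ (inside ∷_)) F′
        , (λ { (inside ∷ e) Fe → Fe ; (outside ∷ e) → F′⊑ e })
        , trans (cong (λ z → card (F ∘ (inside ∷_)) + z) eq) (m+[n∸m]≡n (≰⇒≥ k≰in))

card-∁ : (F : Family n) → card (F ∘ ∁) ≡ card F
card-∁ {zero}  F = refl
card-∁ {suc n} F = trans (cong₂ _+_ (card-∁ (F ∘ (outside ∷_))) (card-∁ (F ∘ (inside ∷_))))
                         (+-comm (card (F ∘ (outside ∷_))) _)

-- `insertAt` relabels the vertices other than `w`, so both families live on one vertex fewer and
-- inductions can apply to them.
link del : Family (suc n) → Fin (suc n) → Family n
link F w e = F (insertAt e w inside)
del  F w e = F (insertAt e w outside)

card-link-del : (F : Family (suc n)) (w : Fin (suc n)) → card F ≡ card (link F w) + card (del F w)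
card-link-del         F zero    = refl
card-link-del {suc n} F (suc w) =
  trans (cong₂ _+_ (card-link-del (F ∘ (inside ∷_)) w) (card-link-del (F ∘ (outside ∷_)) w))
        (interchange (card (link (F ∘ (inside ∷_)) w)) _ _ _)

∣insertAt-inside∣ : (e : Subset n) (w : Fin (suc n)) → ∣ insertAt e w inside ∣ ≡ suc ∣ e ∣
∣insertAt-inside∣ e             zero    = refl
∣insertAt-inside∣ (inside  ∷ e) (suc w) = cong suc (∣insertAt-inside∣ e w)
∣insertAt-inside∣ (outside ∷ e) (suc w) = ∣insertAt-inside∣ e w

∣insertAt-outside∣ : (e : Subset n) (w : Fin (suc n)) → ∣ insertAt e w outside ∣ ≡ ∣ e ∣
∣insertAt-outside∣ e             zero    = refl
∣insertAt-outside∣ (inside  ∷ e) (suc w) = cong suc (∣insertAt-outside∣ e w)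
∣insertAt-outside∣ (outside ∷ e) (suc w) = ∣insertAt-outside∣ e w

-- The first inclusion supplies the comparison of the heads: `inside` is never above `outside`.
∷-⊆ : ∀ {a b} {d e : Subset n} {d′ e′ : Subset k} → a ∷ d ⊆ b ∷ e → d′ ⊆ e′ → a ∷ d′ ⊆ b ∷ e′
∷-⊆ {a = outside}              ad⊆be d⊆e = out⊆ d⊆e
∷-⊆ {a = inside} {b = inside}  ad⊆be d⊆e = in⊆in d⊆e
∷-⊆ {a = inside} {b = outside} ad⊆be d⊆e with () ← ad⊆be Vec.here

insertAt-⊆ : {d e : Subset n} (w : Fin (suc n)) → d ⊆ e → insertAt d w inside ⊆ insertAt e w inside
insertAt-⊆ zero d⊆e = in⊆in d⊆e
insertAt-⊆ {d = x ∷ d} {y ∷ e} (suc w) d⊆e = ∷-⊆ d⊆e (insertAt-⊆ w (drop-∷-⊆ d⊆e))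

insertAt-outside-⊆ : {d e : Subset n} (w : Fin (suc n)) → d ⊆ e → insertAt d w outside ⊆ insertAt e w inside
insertAt-outside-⊆ zero d⊆e = out⊆ d⊆e
insertAt-outside-⊆ {d = x ∷ d} {y ∷ e} (suc w) d⊆e = ∷-⊆ d⊆e (insertAt-outside-⊆ w (drop-∷-⊆ d⊆e))

link-uniform : {F : Family (suc n)} (w : Fin (suc n)) → Uniform (suc k) F → Uniform k (link F w)
link-uniform w u e Fe = suc-injective (trans (sym (∣insertAt-inside∣ e w)) (u _ Fe))

del-uniform : {F : Family (suc n)} (w : Fin (suc n)) → Uniform k F → Uniform k (del F w)
del-uniform w u e Fe = trans (sym (∣insertAt-outside∣ e w)) (u _ Fe)

-- The size of the link once more, but by recursion on the vertices in step with `card`, so that the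
-- double count `sum-degree` is an induction on `n`.
degree : Family n → Fin n → ℕ
degree F zero    = card (F ∘ (inside ∷_))
degree F (suc w) = degree (F ∘ (inside ∷_)) w + degree (F ∘ (outside ∷_)) w

degree≡card-link : (F : Family (suc n)) (w : Fin (suc n)) → degree F w ≡ card (link F w)
degree≡card-link         F zero    = refl
degree≡card-link {suc n} F (suc w) =
  cong₂ _+_ (degree≡card-link (F ∘ (inside ∷_)) w) (degree≡card-link (F ∘ (outside ∷_)) w)

sum-degree : (F : Family n) → Uniform k F → sum (degree F) ≡ k * card F
sum-degree {zero} {k} F u with F [] in eq
... | false = sym (*-zeroʳ k)
... | true  with refl ← u [] eq = refl
sum-degree {suc n} {k} F u = begin
  a + sum (λ w → degree F₁ w + degree F₀ w)
    ≡⟨ cong (λ z → a + z) (∑-distrib-+ (degree F₁) (degree F₀)) ⟩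
  a + (sum (degree F₁) + sum (degree F₀))
    ≡⟨ cong (λ z → a + (sum (degree F₁) + z)) (sum-degree F₀ (λ e Fe → u _ Fe)) ⟩
  a + (sum (degree F₁) + k * b)
    ≡⟨ +-assoc a _ _ ⟨
  a + sum (degree F₁) + k * b
    ≡⟨ cong (_+ k * b) (inside-part k u) ⟩
  k * a + k * b
    ≡⟨ *-distribˡ-+ k a b ⟨
  k * (a + b) ∎
  where
  open ≡-Reasoning
  F₁ = F ∘ (inside ∷_)
  F₀ = F ∘ (outside ∷_)
  a = card F₁
  b = card F₀
  -- Sets containing the first vertex lose one element in `F₁`, so the uniformity must be a
  -- successor; for `k` zero there are no such sets.
  inside-part : ∀ k → Uniform k F → a + sum (degree F₁) ≡ k * a
  inside-part (suc k) u = cong (λ z → a + z) (sum-degree F₁ (λ e Fe → suc-injective (u _ Fe)))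
  inside-part zero    u =
    cong₂ _+_ (card≡0 {F = F₁} ∄) (sum-degree {k = 0} F₁ (λ e Fe → ⊥-elim (∄ e Fe)))
    where
    ∄ : ∀ e → F₁ e ≢ true
    ∄ e Fe = 1+n≢0 (u _ Fe)

sum-card-link : (F : Family (suc n)) → Uniform k F → sum (λ w → card (link F w)) ≡ k * card F
sum-card-link F u = trans (sym (sum-cong-≗ (degree≡card-link F))) (sum-degree F u)

-- Shadows: the Lovász bound and its stability

-- Containment rather than equality: it survives passing to subfamilies of `F` and to links, and it
-- is all that the intersection property yields.
ContainsShadow : ℕ → Family n → Family n → Set
ContainsShadow s F D = ∀ e d → F e ≡ true → d ⊆ e → ∣ d ∣ ≡ s → D d ≡ true

link-shadow : {F D : Family (suc n)} (w : Fin (suc n)) →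
  ContainsShadow (suc s) F D → ContainsShadow s (link F w) (link D w)
link-shadow w sh e d Fe d⊆e ∣d∣≡s =
  sh _ _ Fe (insertAt-⊆ w d⊆e) (trans (∣insertAt-inside∣ d w) (cong suc ∣d∣≡s))

-- A subset of a link member also lies in the original member and avoids `w`. Together with
-- `link-shadow`, one link of `F` thus controls both halves of `D`, at two consecutive levels.
del-shadow : {F D : Family (suc n)} (w : Fin (suc n)) →
  ContainsShadow s F D → ContainsShadow s (link F w) (del D w)
del-shadow w sh e d Fe d⊆e ∣d∣≡s =
  sh _ _ Fe (insertAt-outside-⊆ w d⊆e) (trans (∣insertAt-outside∣ d w) ∣d∣≡s)

∀≤⊎∃> : (f g : Fin n → ℕ) → (∀ w → f w ≤ g w) ⊎ ∃[ w ] g w < f w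
∀≤⊎∃> f g with all? (λ w → f w ≤? g w)
... | yes f≤g = inj₁ f≤g
... | no  f≰g with ¬∀⟶∃¬ _ _ (λ w → f w ≤? g w) f≰g
...   | w , fw≰gw = inj₂ (w , ≰⇒> fw≰gw)

-- Summing over `w` counts each member of `F` `suc t` times and each member of `D` `suc s` times;
-- `absorption` takes up exactly these factors. The weights `a` and `b` carry the gain in
-- `shadow-stability`.
average-links : ∀ a b {F D : Family (suc n)} → Uniform (suc t) F → Uniform (suc s) D →
  (∀ w → a * (y C s) * card (link F w) ≤ b * (y C t) * card (link D w)) →
  a * (suc y C suc s) * card F ≤ b * (suc y C suc t) * card D
average-links {t = t} {s} {y} a b {F} {D} uF uD links = *-cancelˡ-≤ (suc s * suc t) (begin
  suc s * suc t * (a * (suc y C suc s) * f)          ≡⟨ rearrange₁ (suc s) (suc t) a (suc y C suc s) f ⟩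
  a * (suc s * (suc y C suc s)) * (suc t * f)        ≡⟨ cong (λ z → a * z * (suc t * f)) (absorption y s) ⟩
  a * (suc y * (y C s)) * (suc t * f)                ≡⟨ rearrange₂ (suc y) a (y C s) (suc t * f) ⟩
  suc y * (a * (y C s) * (suc t * f))                ≤⟨ *-monoʳ-≤ (suc y) summed ⟩
  suc y * (b * (y C t) * (suc s * d))                ≡⟨ rearrange₂ (suc y) b (y C t) (suc s * d) ⟨
  b * (suc y * (y C t)) * (suc s * d)                ≡⟨ cong (λ z → b * z * (suc s * d)) (absorption y t) ⟨
  b * (suc t * (suc y C suc t)) * (suc s * d)        ≡⟨ rearrange₁ (suc t) (suc s) b (suc y C suc t) d ⟨
  suc t * suc s * (b * (suc y C suc t) * d)
    ≡⟨ cong (_* (b * (suc y C suc t) * d)) (*-comm (suc t) (suc s)) ⟩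
  suc s * suc t * (b * (suc y C suc t) * d)          ∎)
  where
  open ≤-Reasoning
  f = card F
  d = card D
  rearrange₁ : ∀ p q a c f → p * q * (a * c * f) ≡ a * (p * c) * (q * f)
  rearrange₁ = solve-∀
  rearrange₂ : ∀ p a c f → a * (p * c) * f ≡ p * (a * c * f)
  rearrange₂ = solve-∀
  summed : a * (y C s) * (suc t * f) ≤ b * (y C t) * (suc s * d)
  summed = begin
    a * (y C s) * (suc t * f)                        ≡⟨ cong (a * (y C s) *_) (sum-card-link F uF) ⟨
    a * (y C s) * sum (λ w → card (link F w))        ≡⟨ *-distribˡ-sum (a * (y C s)) (λ w → card (link F w)) ⟩
    sum (λ w → a * (y C s) * card (link F w))        ≤⟨ sum-mono links ⟩
    sum (λ w → b * (y C t) * card (link D w))        ≡⟨ *-distribˡ-sum (b * (y C t)) (λ w → card (link D w)) ⟨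
    b * (y C t) * sum (λ w → card (link D w))        ≡⟨ cong (b * (y C t) *_) (sum-card-link D uD) ⟩
    b * (y C t) * (suc s * d)                        ∎

-- The ratio of `card D` to `card F` is at least that for all sets on `y` points. The size
-- hypothesis is an upper bound because this ratio falls as `y` grows. Being linear in both
-- cardinalities, this form can be averaged over links.
ShadowBound : ℕ → ℕ → ℕ → Set
ShadowBound y t s = ∀ {n} {F D : Family n} → Uniform t F → Uniform s D → ContainsShadow s F D →
  card F ≤ y C t → (y C s) * card F ≤ (y C t) * card D

-- The version for a family containing at least the share a/b of `y C t`. Below `y C t` the ratio
-- bound transfers the share to `D`.
shadow-of-large : ShadowBound y t s → t ≤ y → ∀ {n} {F D : Family n} →
  Uniform t F → Uniform s D → ContainsShadow s F D →
  ∀ {a b} → a ≤ b → a * (y C t) ≤ b * card F → a * (y C s) ≤ b * card D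
shadow-of-large {y} {t} {s} bound t≤y {F = F} {D} uF uD sh {a} {b} a≤b large with ≤-total (card F) (y C t)
... | inj₁ small = *-cancelˡ-≤ (y C t) {{>-nonZero (C-pos t≤y)}} (begin
  (y C t) * (a * (y C s))    ≡⟨ rearrange (y C t) a (y C s) ⟩
  (y C s) * (a * (y C t))    ≤⟨ *-monoʳ-≤ (y C s) large ⟩
  (y C s) * (b * card F)     ≡⟨ x∙yz≈y∙xz (y C s) b (card F) ⟩
  b * ((y C s) * card F)     ≤⟨ *-monoʳ-≤ b (bound uF uD sh small) ⟩
  b * ((y C t) * card D)     ≡⟨ x∙yz≈y∙xz b (y C t) (card D) ⟩
  (y C t) * (b * card D)     ∎)
  where
  open ≤-Reasoning
  rearrange : ∀ p q r → p * (q * r) ≡ r * (q * p)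
  rearrange = solve-∀
-- Truncated to exactly `y C t` members, the family already forces `y C s` sets into `D`, and a ≤ b.
... | inj₂ big with subfamily F big
...   | F′ , F′⊑F , ∣F′∣ = *-mono-≤ a≤b (*-cancelˡ-≤ (y C t) {{>-nonZero (C-pos t≤y)}} (begin
  (y C t) * (y C s)    ≡⟨ *-comm (y C t) (y C s) ⟩
  (y C s) * (y C t)    ≡⟨ cong ((y C s) *_) ∣F′∣ ⟨
  (y C s) * card F′    ≤⟨ bound (λ e → uF e ∘ F′⊑F e) uD (λ e d → sh e d ∘ F′⊑F e) (≤-reflexive ∣F′∣) ⟩
  (y C t) * card D     ∎))
  where open ≤-Reasoning

-- The link and the deletion of `D` receive the shares of `y C s` and `y C suc s`, which Pascal's
-- rule adds up.
large-link : ShadowBound y t s → ShadowBound y t (suc s) → t ≤ y → ∀ {n} {F D : Family (suc n)} →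
  Uniform (suc t) F → Uniform (suc s) D → ContainsShadow (suc s) F D →
  ∀ {a b} → a ≤ b → ∀ w → a * (y C t) ≤ b * card (link F w) → a * (suc y C suc s) ≤ b * card D
large-link {y} {t} {s} bound bound′ t≤y {F = F} {D} uF uD sh {a} {b} a≤b w large = begin
  a * (suc y C suc s)                           ≡⟨ cong (a *_) (nCk+nC[k+1]≡[n+1]C[k+1] y s) ⟨
  a * (y C s + y C suc s)                       ≡⟨ *-distribˡ-+ a (y C s) (y C suc s) ⟩
  a * (y C s) + a * (y C suc s)
    ≤⟨ +-mono-≤ (shadow-of-large bound t≤y (link-uniform w uF) (link-uniform w uD) (link-shadow w sh) a≤b large)
                (shadow-of-large bound′ t≤y (link-uniform w uF) (del-uniform w uD) (del-shadow w sh) a≤b large) ⟩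
  b * card (link D w) + b * card (del D w)      ≡⟨ *-distribˡ-+ b _ _ ⟨
  b * (card (link D w) + card (del D w))        ≡⟨ cong (b *_) (card-link-del D w) ⟨
  b * card D                                    ∎
  where open ≤-Reasoning

Uniform-suc-0 : {F : Family 0} → Uniform (suc k) F → card F ≡ 0
Uniform-suc-0 {F = F} uF = card≡0 {F = F} λ { [] Fe → 1+n≢0 (sym (uF [] Fe)) }

∅∈shadow : {F D : Family n} → ContainsShadow 0 F D → ∀ {e} → F e ≡ true → 0 < card D
∅∈shadow {n = n} {D = D} sh {e} Fe = card-pos {F = D} ∅ (sh e ∅ Fe ⊥⊆ (∣⊥∣≡0 n))

-- The induction lowers `y`, `t` and `s` together. The case s = t is split off because a large link
-- calls for level `suc s` besides `s`, still under `t`.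
shadowBound : ∀ {y t s} → s ≤ t → t ≤ y → ShadowBound y t s
shadowBound {y} {t} {zero} _ _ {F = F} {D} uF uD sh small with empty⊎inhabited F
... | inj₁ ∣F∣≡0 rewrite ∣F∣≡0 = ≤-trans (≤-reflexive (*-zeroʳ (y C 0))) z≤n
... | inj₂ (e , Fe) = begin
  (y C 0) * card F     ≡⟨ *-identityˡ (card F) ⟩
  card F               ≤⟨ small ⟩
  y C t                ≤⟨ m≤m*n (y C t) (card D) {{>-nonZero (∅∈shadow sh Fe)}} ⟩
  (y C t) * card D     ∎
  where open ≤-Reasoning
shadowBound {suc y} {suc t} {suc s} (s≤s s≤t) (s≤s t≤y) {zero} {F} {D} uF uD sh small
  rewrite Uniform-suc-0 {F = F} uF = ≤-trans (≤-reflexive (*-zeroʳ (suc y C suc s))) z≤n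
shadowBound {suc y} {suc t} {suc s} (s≤s s≤t) (s≤s t≤y) {suc n} {F} {D} uF uD sh small
  with m≤n⇒m<n∨m≡n s≤t | ∀≤⊎∃> (λ w → card (link F w)) (λ _ → y C t)
... | inj₂ refl | _ = *-monoʳ-≤ (suc y C suc t) (card-mono λ e Fe → sh e e Fe id (uF e Fe))
... | inj₁ s<t  | inj₁ small-links = subst₂ _≤_ (unit (suc y C suc s) _) (unit (suc y C suc t) _)
  (average-links 1 1 uF uD λ w →
    subst₂ _≤_ (sym (unit (y C s) _)) (sym (unit (y C t) _))
      (shadowBound s≤t t≤y (link-uniform w uF) (link-uniform w uD) (link-shadow w sh) (small-links w)))
  where
  unit : ∀ p q → 1 * p * q ≡ p * q
  unit p q = cong (_* q) (*-identityˡ p)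
-- Here `D` has full size `suc y C suc s` from one link, and `F` is at most `suc y C suc t` by
-- hypothesis.
... | inj₁ s<t  | inj₂ (w , big) = begin
  (suc y C suc s) * card F             ≤⟨ *-monoʳ-≤ (suc y C suc s) small ⟩
  (suc y C suc s) * (suc y C suc t)    ≡⟨ *-comm (suc y C suc s) _ ⟩
  (suc y C suc t) * (suc y C suc s)    ≤⟨ *-monoʳ-≤ (suc y C suc t) ∣D∣-large ⟩
  (suc y C suc t) * card D             ∎
  where
  open ≤-Reasoning
  ∣D∣-large : suc y C suc s ≤ card D
  ∣D∣-large = subst₂ _≤_ (*-identityˡ _) (*-identityˡ _)
    (large-link (shadowBound s≤t t≤y) (shadowBound s<t t≤y) t≤y uF uD sh {1} {1} ≤-refl w
      (*-monoʳ-≤ 1 (<⇒≤ big)))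

-- (K + 1) (K - s - 1) ≤ K (K - s), where j = K - s - 1.
gain-arith : ∀ s j c c′ f d → let K = suc s + j in
  K * f ≤ j * c → suc j * c′ ≤ K * d → suc K * c′ * f ≤ K * c * d
gain-arith s j c c′ f d Kf≤jc [1+j]c′≤Kd = *-cancelˡ-≤ K (begin
  K * (suc K * c′ * f)           ≡⟨ e₁ K c′ f ⟩
  suc K * c′ * (K * f)           ≤⟨ *-monoʳ-≤ (suc K * c′) Kf≤jc ⟩
  suc K * c′ * (j * c)           ≡⟨ e₂ K c′ j c ⟩
  (K * j + j) * (c * c′)         ≤⟨ *-monoˡ-≤ (c * c′) (+-monoʳ-≤ (K * j) (m≤n+m j (suc s))) ⟩
  (K * j + K) * (c * c′)         ≡⟨ e₃ K c′ j c ⟩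
  K * c * (suc j * c′)           ≤⟨ *-monoʳ-≤ (K * c) [1+j]c′≤Kd ⟩
  K * c * (K * d)                ≡⟨ e₄ K c d ⟩
  K * (K * c * d)                ∎)
  where
  open ≤-Reasoning
  K = suc s + j
  e₁ : ∀ K c′ f → K * ((1 + K) * c′ * f) ≡ (1 + K) * c′ * (K * f)
  e₁ = solve-∀
  e₂ : ∀ K c′ j c → (1 + K) * c′ * (j * c) ≡ (K * j + j) * (c * c′)
  e₂ = solve-∀
  e₃ : ∀ K c′ j c → (K * j + K) * (c * c′) ≡ K * c * ((1 + j) * c′)
  e₃ = solve-∀
  e₄ : ∀ K c d → K * c * (K * d) ≡ K * (K * c * d)
  e₄ = solve-∀

-- The parameter `j` is K - s - 1, so `F` has at most the share 1 - (s + 1)/K. Passing to links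
-- lowers `s` and raises `j`, keeping `K` and hence the gain fixed; the share allowed to a link
-- rises to (j + 1)/K.
shadow-stability : ∀ {y t s} j → s < t → t ≤ y → ∀ {n} {F D : Family n} →
  Uniform t F → Uniform s D → ContainsShadow s F D → let K = suc s + j in
  K * card F ≤ j * (y C t) → suc K * (y C s) * card F ≤ K * (y C t) * card D
shadow-stability {y} {t} {zero} j s<t t≤y {F = F} {D} uF uD sh small with empty⊎inhabited F
... | inj₁ ∣F∣≡0 rewrite ∣F∣≡0 = ≤-trans (≤-reflexive (*-zeroʳ (suc (suc j) * (y C 0)))) z≤n
... | inj₂ (e , Fe) = gain-arith 0 j (y C t) (y C 0) (card F) (card D) small
  (*-monoʳ-≤ (suc j) (∅∈shadow sh Fe))
shadow-stability {suc y} {suc t} {suc s} j (s≤s s<t) (s≤s t≤y) {zero} {F} {D} uF uD sh small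
  rewrite Uniform-suc-0 {F = F} uF =
  ≤-trans (≤-reflexive (*-zeroʳ (suc (suc (suc s) + j) * (suc y C suc s)))) z≤n
shadow-stability {suc y} {suc t} {suc s} j (s≤s s<t) (s≤s t≤y) {suc n} {F} {D} uF uD sh small
  with ∀≤⊎∃> (λ w → (suc (suc s) + j) * card (link F w)) (λ _ → suc j * (y C t))
... | inj₁ small-links = average-links (suc (suc (suc s) + j)) (suc (suc s) + j) uF uD λ w →
  subst (λ K → suc K * (y C s) * card (link F w) ≤ K * (y C t) * card (link D w)) (+-suc (suc s) j)
    (shadow-stability (suc j) s<t t≤y (link-uniform w uF) (link-uniform w uD) (link-shadow w sh)
      (subst (λ K → K * card (link F w) ≤ suc j * (y C t)) (sym (+-suc (suc s) j)) (small-links w)))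
-- This link gives `D` the share (j + 1)/K of `suc y C suc s`, while `F` has at most the share j/K
-- of `suc y C suc t`; `gain-arith` compares the two.
... | inj₂ (w , big) =
  gain-arith (suc s) j (suc y C suc t) (suc y C suc s) (card F) (card D) small
    (large-link (shadowBound (<⇒≤ s<t) t≤y) (shadowBound s<t t≤y) t≤y uF uD sh
      (s≤s (m≤n+m j (suc s))) w (<⇒≤ big))

-- Intersecting families as a shadow problem

-- With the Boolean test `≡ᵇ` the sections at the first vertex reduce by computation to `nonMembers`
-- of the sections, so `card-nonMembers` is just Pascal's rule.
nonMembers : ℕ → Family n → Family n
nonMembers s B d = (∣ d ∣ ≡ᵇ s) ∧ not (B d)

nonMembers⁺ : {B : Family n} (d : Subset n) → ∣ d ∣ ≡ s → B d ≢ true → nonMembers s B d ≡ true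
nonMembers⁺ {B = B} d refl Bd≢true =
  cong₂ _∧_ (Equivalence.to Bool.T-≡ (≡⇒≡ᵇ ∣ d ∣ ∣ d ∣ refl)) (cong not (Bool.¬-not Bd≢true))

nonMembers-uniform : {B : Family n} → Uniform s (nonMembers s B)
nonMembers-uniform {s = s} d p with ∣ d ∣ ≡ᵇ s in eq
... | true = ≡ᵇ⇒≡ ∣ d ∣ s (Equivalence.from Bool.T-≡ eq)

card-nonMembers : (B : Family n) → Uniform s B → card B + card (nonMembers s B) ≡ n C s
card-nonMembers {zero} {zero} B u with B []
... | true  = refl
... | false = refl
card-nonMembers {zero} {suc s} B u with B [] in eq
... | true  = contradiction (u [] eq) λ ()
... | false = refl
card-nonMembers {suc n} {zero} B u = begin
  card B₁ + card B₀ + (card D₁ + card D₀)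
    ≡⟨ cong₂ (λ a b → a + card B₀ + (b + card D₀)) (card≡0 {F = B₁} λ e Be → contradiction (u _ Be) λ ())
                                                   (card≡0 {F = D₁} λ _ ()) ⟩
  card B₀ + card D₀
    ≡⟨ card-nonMembers B₀ (u ∘ (outside ∷_)) ⟩
  n C 0 ∎
  where
  open ≡-Reasoning
  B₁ = B ∘ (inside ∷_)
  B₀ = B ∘ (outside ∷_)
  D₁ = nonMembers 0 B ∘ (inside ∷_)
  D₀ = nonMembers 0 B ∘ (outside ∷_)
card-nonMembers {suc n} {suc s} B u = begin
  card B₁ + card B₀ + (card D₁ + card D₀)
    ≡⟨ interchange (card B₁) _ _ _ ⟩
  (card B₁ + card D₁) + (card B₀ + card D₀)
    ≡⟨ cong₂ _+_ (card-nonMembers B₁ (λ e → suc-injective ∘ u (inside ∷ e)))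
                 (card-nonMembers B₀ (u ∘ (outside ∷_))) ⟩
  n C s + n C suc s
    ≡⟨ nCk+nC[k+1]≡[n+1]C[k+1] n s ⟩
  suc n C suc s ∎
  where
  open ≡-Reasoning
  B₁ = B ∘ (inside ∷_)
  B₀ = B ∘ (outside ∷_)
  D₁ = nonMembers (suc s) B ∘ (inside ∷_)
  D₀ = nonMembers (suc s) B ∘ (outside ∷_)

C-absorbʳ : ∀ a b → suc b * (suc (a + b) C a) ≡ suc (a + b) * ((a + b) C b)
C-absorbʳ a b = begin
  suc b * (suc (a + b) C a)      ≡⟨ cong (λ z → suc b * (z C a)) (+-suc a b) ⟨
  suc b * ((a + suc b) C a)      ≡⟨ cong (suc b *_) (C-sym a (suc b)) ⟩
  suc b * ((a + suc b) C suc b)  ≡⟨ cong (λ z → suc b * (z C suc b)) (+-suc a b) ⟩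
  suc b * (suc (a + b) C suc b)  ≡⟨ absorption (a + b) b ⟩
  suc (a + b) * ((a + b) C b)    ∎
  where open ≡-Reasoning

C-shift : ∀ a b → suc a * (suc (a + b) C suc a) ≡ suc b * (suc (a + b) C a)
C-shift a b = begin
  suc a * (suc (a + b) C suc a)  ≡⟨ absorption (a + b) a ⟩
  suc (a + b) * ((a + b) C a)    ≡⟨ cong (suc (a + b) *_) (C-sym a b) ⟩
  suc (a + b) * ((a + b) C b)    ≡⟨ C-absorbʳ a b ⟨
  suc b * (suc (a + b) C a)      ∎
  where open ≡-Reasoning

IntersectingFamily : Family n → Set
IntersectingFamily G = ∀ e f → G e ≡ true → G f ≡ true → Nonempty (e ∩ f)

-- Complementing within the vertices other than `w` turns disjointness from an avoiding edge into
-- inclusion in a member.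
coAvoiding : Family (suc n) → Fin (suc n) → Family n
coAvoiding G w = del G w ∘ ∁

coAvoiding-uniform : {G : Family (suc (s + t))} (w : Fin (suc (s + t))) →
  Uniform s G → Uniform t (coAvoiding G w)
coAvoiding-uniform {s} {t} w u e Ge = begin
  ∣ e ∣                          ≡⟨ m∸[m∸n]≡n (∣p∣≤n e) ⟨
  s + t ∸ (s + t ∸ ∣ e ∣)        ≡⟨ cong (s + t ∸_) (∣∁p∣≡n∸∣p∣ e) ⟨
  s + t ∸ ∣ ∁ e ∣                ≡⟨ cong (s + t ∸_) (del-uniform w u (∁ e) Ge) ⟩
  s + t ∸ s                      ≡⟨ m+n∸m≡n s t ⟩
  t                              ∎
  where open ≡-Reasoning

-- If `d` lies in the complement of an edge avoiding `w`, then `d` with `w` added is disjoint from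
-- that edge and cannot itself be an edge.
coAvoiding-shadow : {G : Family (suc n)} (w : Fin (suc n)) → IntersectingFamily G →
  ContainsShadow s (coAvoiding G w) (nonMembers s (link G w))
coAvoiding-shadow {G = G} w int e d Ge d⊆e ∣d∣≡s = nonMembers⁺ {B = link G w} d ∣d∣≡s
  λ Gd → disjoint (int _ _ Gd Ge)
  where
  disjoint : ¬ Nonempty (insertAt d w inside ∩ insertAt (∁ e) w outside)
  disjoint (x , x∈) with x∈p∩q⁻ (insertAt d w inside) (insertAt (∁ e) w outside) x∈
  ... | x∈d , x∈∁e = x∈p⇒x∉∁p (insertAt-⊆ w d⊆e x∈d)
    (subst (λ p → x Subset.∈ p) (sym (map-insertAt not inside e w)) x∈∁e)

card-balance : (G : Family (suc n)) (w : Fin (suc n)) → Uniform (suc s) G →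
  card G + card (nonMembers s (link G w)) ≡ card (del G w) + n C s
card-balance {n} {s} G w u = begin
  card G + card D                             ≡⟨ cong (_+ card D) (card-link-del G w) ⟩
  card (link G w) + card (del G w) + card D   ≡⟨ regroup (card (link G w)) _ _ ⟩
  card (del G w) + (card (link G w) + card D)
    ≡⟨ cong (λ z → card (del G w) + z) (card-nonMembers (link G w) (link-uniform w u)) ⟩
  card (del G w) + n C s                      ∎
  where
  open ≡-Reasoning
  D = nonMembers s (link G w)
  regroup : ∀ a b c → a + b + c ≡ b + (a + c)
  regroup = solve-∀

-- The gain reads (K + 1) a ≤ K (a + m), in which K a cancels.
excess-arith : ∀ K c a d m → 0 < c → suc K * c * a ≤ K * c * d → d ≡ a + m → a ≤ K * m
excess-arith K c a d m 0<c le refl = +-cancelˡ-≤ (K * a) _ _ (*-cancelˡ-≤ c {{>-nonZero 0<c}} (begin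
  c * (K * a + a)        ≡⟨ e₁ K c a ⟩
  suc K * c * a          ≤⟨ le ⟩
  K * c * (a + m)        ≡⟨ e₂ K c a m ⟩
  c * (K * a + K * m)    ∎))
  where
  open ≤-Reasoning
  e₁ : ∀ K c a → c * (K * a + a) ≡ (1 + K) * c * a
  e₁ = solve-∀
  e₂ : ∀ K c a m → K * c * (a + m) ≡ c * (K * a + K * m)
  e₂ = solve-∀

-- Here σ is the degree sum of `g` edges on n = s + t + 2 vertices, and `b` and `a` count those
-- containing and avoiding a vertex of at least average degree. Then n a ≤ n g - (s + 1) g = (t + 1)
-- g.
average-arith : ∀ s t g a b σ M Nc → σ ≡ suc s * g → σ ≤ suc (suc s + t) * b → g ≡ b + a → g ≤ M →
  suc t * M ≡ Nc → suc (suc s + t) * a ≤ Nc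
average-arith s t g a b σ M Nc σ≡ avg refl g≤M refl = +-cancelˡ-≤ (suc s * g) _ _ (begin
  suc s * g + suc (suc s + t) * a                      ≡⟨ cong (_+ suc (suc s + t) * a) σ≡ ⟨
  σ + suc (suc s + t) * a                              ≤⟨ +-monoˡ-≤ _ avg ⟩
  suc (suc s + t) * b + suc (suc s + t) * a            ≡⟨ split s t a b ⟩
  suc s * g + suc t * g                                ≤⟨ +-monoʳ-≤ (suc s * g) (*-monoʳ-≤ (suc t) g≤M) ⟩
  suc s * g + suc t * M                                ∎)
  where
  open ≤-Reasoning
  split : ∀ s t a b → (2 + (s + t)) * b + (2 + (s + t)) * a ≡ (1 + s) * (b + a) + (1 + t) * (b + a)
  split = solve-∀

card-del≤1 : {H H′ : Family (suc n)} → H′ ⊑ H → card H ≡ suc (card H′) →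
  ∀ w → card (del H′ w) ≡ 0 → card (del H w) ≤ 1
card-del≤1 {H = H} {H′} H′⊑H ∣H∣ w delH′≡0 = +-cancelˡ-≤ (card (link H w)) _ _ (begin
  card (link H w) + card (del H w)          ≡⟨ card-link-del H w ⟨
  card H                                    ≡⟨ ∣H∣ ⟩
  suc (card H′)                             ≡⟨ cong suc (card-link-del H′ w) ⟩
  suc (card (link H′ w) + card (del H′ w))  ≡⟨ cong (λ z → suc (card (link H′ w) + z)) delH′≡0 ⟩
  suc (card (link H′ w) + 0)                ≡⟨ +-suc (card (link H′ w)) 0 ⟨
  card (link H′ w) + 1                      ≤⟨ +-monoˡ-≤ 1 (card-mono λ e → H′⊑H (insertAt e w inside)) ⟩
  card (link H w) + 1                       ∎)
  where open ≤-Reasoning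

-- The choice j = r N in the stability bound: K = r + r N is r times the number of vertices, and j/K
-- = N/(N + 1) is the share that averaging provides.
rescale : ∀ r N a c m → suc N * a ≤ N * c →
  ((r + r * N) * a ≤ r * N * c → a ≤ (r + r * N) * m) → a ≤ r * suc N * m
rescale r N a c m few excess = subst (λ K → a ≤ K * m) (sym (*-suc r N)) (excess (begin
  (r + r * N) * a    ≡⟨ cong (_* a) (*-suc r N) ⟨
  r * suc N * a      ≡⟨ *-assoc r (suc N) a ⟩
  r * (suc N * a)    ≤⟨ *-monoʳ-≤ r few ⟩
  r * (N * c)        ≡⟨ *-assoc r N c ⟨
  r * N * c          ∎))
  where open ≤-Reasoning

-- The first estimate and the Erdős-Ko-Rado theorem

-- With r = s + 1 and n = s + t + 2 the condition 2r < n becomes s < t. Complements of avoiding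
-- edges are `t`-sets and `D` consists of `s`-sets. The choice y = s + t makes `y C s` and `y C t`
-- equal, so the Lovász bound simply compares cardinalities.
module _ (s t : ℕ) (s<t : s < t) where

  private
    r N : ℕ
    r = suc s
    N = r + t

  module _ {G : Family (suc N)} (u : Uniform r G) (int : IntersectingFamily G) where

    private
      D : Fin (suc N) → Family N
      D w = nonMembers s (link G w)

    card≤-if-few-avoid : ∀ w → card (del G w) ≤ (s + t) C t → card G ≤ N C s
    card≤-if-few-avoid w few = +-cancelʳ-≤ (card (D w)) (card G) (N C s) (begin
      card G + card (D w)              ≡⟨ card-balance G w u ⟩
      card (del G w) + N C s           ≤⟨ +-monoˡ-≤ (N C s) a≤d ⟩
      card (D w) + N C s               ≡⟨ +-comm (card (D w)) _ ⟩
      N C s + card (D w)               ∎)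
      where
      open ≤-Reasoning
      a≤d : card (del G w) ≤ card (D w)
      a≤d = *-cancelˡ-≤ ((s + t) C t) {{>-nonZero (C-pos (m≤n+m t s))}} (begin
        ((s + t) C t) * card (del G w)           ≡⟨ cong₂ _*_ (C-sym s t) (card-∁ (del G w)) ⟨
        ((s + t) C s) * card (coAvoiding G w)
          ≤⟨ shadowBound (<⇒≤ s<t) (m≤n+m t s)
               (coAvoiding-uniform w u) nonMembers-uniform (coAvoiding-shadow w int)
               (subst (_≤ (s + t) C t) (sym (card-∁ (del G w))) few) ⟩
        ((s + t) C t) * card (D w)               ∎)

    -- The deficiency enters through an equation instead of `∸`, so that the case m = 0 is at hand
    -- for the proof of Erdős-Ko-Rado itself.
    module _ {m : ℕ} (∣G∣+m : card G + m ≡ N C s) where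

      card-nonMembers-link : ∀ w → card (D w) ≡ card (del G w) + m
      card-nonMembers-link w = +-cancelˡ-≡ (card G) _ _ (begin
        card G + card (D w)          ≡⟨ card-balance G w u ⟩
        card (del G w) + N C s       ≡⟨ cong (λ z → card (del G w) + z) ∣G∣+m ⟨
        card (del G w) + (card G + m) ≡⟨ regroup (card (del G w)) _ m ⟩
        card G + (card (del G w) + m) ∎)
        where
        open ≡-Reasoning
        regroup : ∀ a g m → a + (g + m) ≡ g + (a + m)
        regroup = solve-∀

      popular-vertex : ∃[ w ] suc N * card (del G w) ≤ N * ((s + t) C t)
      popular-vertex =
        let w , avg = exists≥average (λ w → card (link G w)) in
        w , average-arith s t (card G) (card (del G w)) (card (link G w)) (sum (λ w → card (link G w))) (N C s) _
              (sum-card-link G u) avg (card-link-del G w)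
              (m+n≤o⇒m≤o (card G) (≤-reflexive ∣G∣+m)) (C-absorbʳ s t)

      avoid≤excess : ∀ w j → let K = r + j in
        K * card (del G w) ≤ j * ((s + t) C t) → card (del G w) ≤ K * m
      avoid≤excess w j few = excess-arith (r + j) _ _ _ m (C-pos (m≤n+m t s)) stable′ (card-nonMembers-link w)
        where
        stable : suc (r + j) * ((s + t) C s) * card (coAvoiding G w) ≤ (r + j) * ((s + t) C t) * card (D w)
        stable = shadow-stability j s<t (m≤n+m t s) (coAvoiding-uniform w u) nonMembers-uniform
          (coAvoiding-shadow w int)
          (subst (λ a → (r + j) * a ≤ j * ((s + t) C t)) (sym (card-∁ (del G w))) few)
        stable′ : suc (r + j) * ((s + t) C t) * card (del G w) ≤ (r + j) * ((s + t) C t) * card (D w)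
        stable′ = subst₂ (λ c a → suc (r + j) * c * a ≤ (r + j) * ((s + t) C t) * card (D w))
          (C-sym s t) (card-∁ (del G w)) stable

      few-avoid-popular : ∃[ w ] card (del G w) ≤ r * suc N * m
      few-avoid-popular =
        let w , few = popular-vertex in w , rescale r N _ ((s + t) C t) m few (avoid≤excess w (r * N))

  -- Among M + 1 edges some M would form a full star, whose centre at most one edge avoids.
  erdős-ko-rado : {G : Family (suc N)} → Uniform r G → IntersectingFamily G → card G ≤ N C s
  erdős-ko-rado {G} u int = ≮⇒≥ λ C<G →
    let H , H⊑G , ∣H∣   = subfamily G C<G
        uH              = λ e → u e ∘ H⊑G e
        intH            = λ e f p q → int e f (H⊑G e p) (H⊑G f q)
        H′ , H′⊑H , ∣H′∣ = subfamily H (≤-trans (n≤1+n _) (≤-reflexive (sym ∣H∣)))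
        w , few         = few-avoid-popular {H′} (λ e → uH e ∘ H′⊑H e) (λ e f p q → intH e f (H′⊑H e p) (H′⊑H f q))
                            {0} (trans (+-identityʳ _) ∣H′∣)
        delH≤1          = card-del≤1 {H = H} {H′} H′⊑H (trans ∣H∣ (cong suc (sym ∣H′∣))) w
                            (n≤0⇒n≡0 (≤-trans few (≤-reflexive (*-zeroʳ (r * suc N)))))
    in <⇒≱ (≤-reflexive (sym ∣H∣))
         (card≤-if-few-avoid {H} uH intH w (≤-trans delH≤1 (C-pos (m≤n+m t s))))

-- The refined estimate

-- Two absorptions, each costing a factor at most n. The right side holds the size threshold of the
-- Lovász bound with `y` lowered by one.
binomial-drop : ∀ s t → let n = suc (suc (suc s) + t) in (suc (suc s) + t) C suc s ≤ n * n * ((s + t) C t)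
binomial-drop s t = begin
  (suc (suc s) + t) C suc s                                ≤⟨ m≤n*m _ (suc s) ⟩
  suc s * ((suc (suc s) + t) C suc s)                      ≡⟨ absorption (suc s + t) s ⟩
  (suc (suc s) + t) * ((suc s + t) C s)
    ≤⟨ *-monoʳ-≤ (suc (suc s) + t) (m≤n*m ((suc s + t) C s) (suc t)) ⟩
  (suc (suc s) + t) * (suc t * ((suc s + t) C s))          ≡⟨ cong ((suc (suc s) + t) *_) (C-absorbʳ s t) ⟩
  (suc (suc s) + t) * ((suc s + t) * ((s + t) C t))        ≡⟨ *-assoc (suc (suc s) + t) (suc s + t) ((s + t) C t) ⟨
  (suc (suc s) + t) * (suc s + t) * ((s + t) C t)
    ≤⟨ *-monoˡ-≤ ((s + t) C t) (*-mono-≤ (n≤1+n (suc (suc s) + t)) (≤-trans (n≤1+n (suc s + t)) (n≤1+n _))) ⟩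
  suc (suc (suc s) + t) * suc (suc (suc s) + t) * ((s + t) C t) ∎
  where open ≤-Reasoning

-- This is where the bound 1/(2rn⁴) is spent: r n m for the first estimate, n² for the binomial
-- drop, and a remaining factor 2n.
scale-down : ∀ r n .{{_ : NonZero n}} a c m M → a ≤ r * n * m → 2 * r * n ^ 4 * m ≤ M → M ≤ n * n * c → a ≤ c
scale-down r n a c m M a≤ m≤ M≤ = *-cancelˡ-≤ (n * n) {{m*n≢0 n n}} (begin
  n * n * a                        ≤⟨ *-monoʳ-≤ (n * n) a≤ ⟩
  n * n * (r * n * m)              ≤⟨ m≤m*n _ (2 * n) {{m*n≢0 2 n}} ⟩
  n * n * (r * n * m) * (2 * n)    ≡⟨ e r n m ⟩
  2 * r * n ^ 4 * m                ≤⟨ m≤ ⟩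
  M                                ≤⟨ M≤ ⟩
  n * n * c                        ∎)
  where
  open ≤-Reasoning
  e : ∀ r n m → n * n * (r * n * m) * (2 * n) ≡ 2 * r * (n * (n * (n * (n * 1)))) * m
  e = solve-∀

-- The quotient of the two binomials is t/(s + 1), so t a ≤ (s + 1)(a + m); since t ≥ s + 2, the
-- terms (s + 1) a cancel and leave one `a`.
refine-arith : ∀ s t a d m → suc s < t →
  ((s + t) C suc s) * a ≤ ((s + t) C t) * d → d ≡ a + m → a ≤ suc s * m
refine-arith s (suc t) a d m s<t le refl = +-cancelˡ-≤ (suc s * a) _ _ (begin
  suc s * a + a              ≡⟨ +-comm (suc s * a) a ⟩
  suc (suc s) * a            ≤⟨ *-monoˡ-≤ a s<t ⟩
  suc t * a                  ≤⟨ *-cancelˡ-≤ c {{>-nonZero (C-pos (m≤m+n s (suc t)))}} scaled ⟩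
  suc s * (a + m)            ≡⟨ *-distribˡ-+ (suc s) a m ⟩
  suc s * a + suc s * m      ∎)
  where
  open ≤-Reasoning
  N = s + suc t
  c = N C s
  shift : suc s * (N C suc s) ≡ suc t * c
  shift = subst (λ z → suc s * (z C suc s) ≡ suc t * (z C s)) (sym (+-suc s t)) (C-shift s t)
  scaled : c * (suc t * a) ≤ c * (suc s * (a + m))
  scaled = begin
    c * (suc t * a)                    ≡⟨ *-assoc c (suc t) a ⟨
    c * suc t * a                      ≡⟨ cong (_* a) (*-comm c (suc t)) ⟩
    suc t * c * a                      ≡⟨ cong (_* a) shift ⟨
    suc s * (N C suc s) * a            ≡⟨ *-assoc (suc s) (N C suc s) a ⟩
    suc s * ((N C suc s) * a)          ≤⟨ *-monoʳ-≤ (suc s) le ⟩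
    suc s * ((N C suc t) * (a + m))    ≡⟨ cong (λ z → suc s * (z * (a + m))) (C-sym s (suc t)) ⟨
    suc s * (c * (a + m))              ≡⟨ x∙yz≈y∙xz (suc s) c (a + m) ⟩
    c * (suc s * (a + m))              ∎

intersecting-stability : ∀ s t → s < t → let N = suc s + t in {G : Family (suc N)} →
  Uniform (suc s) G → IntersectingFamily G → ∀ {m} → card G + m ≡ N C s →
  2 * suc s * suc N ^ 4 * m ≤ N C s → ∃[ w ] card (del G w) ≤ suc s * m
-- For r = 1 the maximum is 1, so the smallness of `m` forces m = 0 and the first estimate suffices.
intersecting-stability zero t s<t {G} u int {m} ∣G∣+m m-small = w , (begin
    card (del G w)               ≤⟨ few ⟩
    1 * suc (1 + t) * m          ≡⟨ cong (1 * suc (1 + t) *_) m≡0 ⟩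
    1 * suc (1 + t) * 0          ≡⟨ *-zeroʳ (1 * suc (1 + t)) ⟩
    0                            ≤⟨ z≤n ⟩
    1 * m                        ∎)
  where
  open ≤-Reasoning
  popular = few-avoid-popular 0 t s<t u int ∣G∣+m
  w = proj₁ popular
  few = proj₂ popular
  m≡0 : m ≡ 0
  m≡0 = n<1⇒n≡0 (*-cancelˡ-< 2 m 1 (≤-<-trans (begin
    2 * m                        ≤⟨ *-monoˡ-≤ m (m≤m*n 2 (suc (1 + t) ^ 4) {{m^n≢0 (suc (1 + t)) 4}}) ⟩
    2 * suc (1 + t) ^ 4 * m      ≤⟨ m-small ⟩
    1                            ∎) (s≤s (s≤s z≤n))))
intersecting-stability (suc s) t s<t {G} u int {m} ∣G∣+m m-small = w , (begin
    card (del G w)       ≤⟨ refine-arith s t _ _ m s<t bound (card-nonMembers-link (suc s) t s<t u int ∣G∣+m w) ⟩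
    suc s * m            ≤⟨ *-monoˡ-≤ m (n≤1+n (suc s)) ⟩
    suc (suc s) * m      ∎)
  where
  open ≤-Reasoning
  popular = few-avoid-popular (suc s) t s<t u int ∣G∣+m
  w = proj₁ popular
  -- The first estimate, with y = suc s + t, admits the Lovász bound for y = s + t.
  few : card (del G w) ≤ (s + t) C t
  few = scale-down (suc (suc s)) (suc (suc (suc s) + t)) _ _ m _ (proj₂ popular) m-small (binomial-drop s t)
  bound : ((s + t) C suc s) * card (del G w) ≤ ((s + t) C t) * card (nonMembers (suc s) (link G w))
  bound = subst (λ a → ((s + t) C suc s) * a ≤ ((s + t) C t) * card (nonMembers (suc s) (link G w))) (card-∁ (del G w))
    (shadowBound (<⇒≤ s<t) (m≤n+m t s) (coAvoiding-uniform w u) nonMembers-uniform (coAvoiding-shadow w int)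
      (subst (_≤ (s + t) C t) (sym (card-∁ (del G w))) few))

-- From edge lists to families, and back to the hypergraph

card-mono-< : {F H : Family n} → F ⊑ H → (e : Subset n) → F e ≢ true → H e ≡ true → card F < card H
card-mono-< {F = F} F⊑H [] Fe≢ He with F []
... | true  = contradiction refl Fe≢
... | false rewrite He = s≤s z≤n
card-mono-< F⊑H (inside  ∷ e) Fe≢ He =
  +-mono-<-≤ (card-mono-< (F⊑H ∘ (inside ∷_)) e Fe≢ He) (card-mono (F⊑H ∘ (outside ∷_)))
card-mono-< F⊑H (outside ∷ e) Fe≢ He =
  +-mono-≤-< (card-mono (F⊑H ∘ (inside ∷_))) (card-mono-< (F⊑H ∘ (outside ∷_)) e Fe≢ He)

module _ {n : ℕ} where
  open DecMembership (≡-dec {n = n} Bool._≟_) using (_∈?_)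

  members : List (Subset n) → Family n
  members es e = does (e ∈? es)

  members⁺ : ∀ es {e} → e ∈ es → members es e ≡ true
  members⁺ es {e} = dec-true (e ∈? es)

  members⁻ : ∀ {es e} → members es e ≡ true → e ∈ es
  members⁻ {es} {e} p with yes e∈es ← e ∈? es = e∈es

-- By distinctness each head is new to the family of its tail. This direction bounds the avoiding
-- edges and, for the whole list, the deficiency from above.
length≤card-members : {es : List (Subset n)} → Unique es → length es ≤ card (members es)
length≤card-members []                 = z≤n
length≤card-members {es = e ∷ es} (e∉es ∷ es!) = ≤-<-trans (length≤card-members es!)
  (card-mono-< {F = members es} {members (e ∷ es)} (λ d p → members⁺ (e ∷ es) (there (members⁻ {es = es} p))) e
    (λ p → All.lookup e∉es (members⁻ p) refl) (members⁺ (e ∷ es) (here refl)))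

∈-insertAt : (e : Subset n) (w : Fin (suc n)) → w Subset.∈ insertAt e w inside
∈-insertAt e       zero    = Vec.here
∈-insertAt (x ∷ e) (suc w) = Vec.there (∈-insertAt e w)

length-edgesAvoiding : (G : Hypergraph k (suc n)) (w : Fin (suc n)) →
  length (edgesAvoiding G w) ≤ card (del (members (edges G)) w)
length-edgesAvoiding G w = begin
  length (edgesAvoiding G w)       ≤⟨ length≤card-members (Unique.filter⁺ avoids? (distinct G)) ⟩
  card A                           ≡⟨ card-link-del A w ⟩
  card (link A w) + card (del A w)
    ≡⟨ cong (_+ card (del A w)) (card≡0 λ e p → proj₂ (∈-A p) (∈-insertAt e w)) ⟩
  card (del A w)
    ≤⟨ card-mono {F = del A w} {del (members (edges G)) w} (λ e p → members⁺ (edges G) (proj₁ (∈-A p))) ⟩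
  card (del (members (edges G)) w) ∎
  where
  open ≤-Reasoning
  avoids? = λ e → ¬? (w ∈ₛ? e)
  A = members (edgesAvoiding G w)
  ∈-A : ∀ {e} → A e ≡ true → e ∈ edges G × w Subset.∉ e
  ∈-A p = ∈-filter⁻ avoids? {xs = edges G} (members⁻ p)

-- The two inequalities say M - size G ≤ M / Q and length (edgesAvoiding G v) ≤ r (M - size G).
hypergraph-stability : ∀ n r → 1 ≤ r → 2 * r < n → (G : Hypergraph r n) → Intersecting G →
  let M = (n ∸ 1) C (r ∸ 1); Q = 2 * r * n ^ 4 in Q * M ≤ Q * size G + M →
  ∃[ v ] length (edgesAvoiding G v) + r * size G ≤ r * M
hypergraph-stability (suc n) (suc s) _ 2r<n G int near with ≤⇒∃ 2r<n
  where
  ≤⇒∃ : ∀ {s n} → 2 * suc s < suc n → ∃[ t ] (s < t × n ≡ suc s + t)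
  ≤⇒∃ {s} {n} (s≤s 2r≤n) = n ∸ suc s
    , m+n≤o⇒m≤o∸n (suc s) (subst (λ z → suc s + z ≤ n) (+-identityʳ (suc s)) 2r≤n)
    , sym (m+[n∸m]≡n (≤-trans (m≤m+n (suc s) _) 2r≤n))
... | t , s<t , refl =
  -- Erdős-Ko-Rado, through `F≤C`, makes the truncated difference a true deficiency.
  let w , few = intersecting-stability s t s<t u int′ (m+[n∸m]≡n F≤C) (deficiency-small Q _ _ _ size≤ near)
  in w , avoiding-arith (suc s) _ _ _ _ _ (length-edgesAvoiding G w) few size≤ F≤C
  where
  open ≤-Reasoning
  Q = 2 * suc s * suc (suc s + t) ^ 4
  F = members (edges G)
  u : Uniform (suc s) F
  u e p = All.lookup (uniform G) (members⁻ p)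
  int′ : IntersectingFamily F
  int′ e f p q = int (members⁻ p) (members⁻ q)
  size≤ : size G ≤ card F
  size≤ = length≤card-members (distinct G)
  F≤C : card F ≤ (suc s + t) C s
  F≤C = erdős-ko-rado s t s<t u int′
  deficiency-small : ∀ Q M z f → z ≤ f → Q * M ≤ Q * z + M → Q * (M ∸ f) ≤ M
  deficiency-small Q M z f z≤f near = begin
    Q * (M ∸ f)          ≡⟨ *-distribˡ-∸ Q M f ⟩
    Q * M ∸ Q * f        ≤⟨ ∸-monoʳ-≤ (Q * M) (*-monoʳ-≤ Q z≤f) ⟩
    Q * M ∸ Q * z        ≤⟨ m≤n+o⇒m∸n≤o (Q * M) (Q * z) near ⟩
    M                    ∎
  avoiding-arith : ∀ r l a z f M → l ≤ a → a ≤ r * (M ∸ f) → z ≤ f → f ≤ M → l + r * z ≤ r * M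
  avoiding-arith r l a z f M l≤a a≤ z≤f f≤M = begin
    l + r * z                ≤⟨ +-mono-≤ (≤-trans l≤a a≤) (*-monoʳ-≤ r z≤f) ⟩
    r * (M ∸ f) + r * f      ≡⟨ *-distribˡ-+ r (M ∸ f) f ⟨
    r * (M ∸ f + f)          ≡⟨ cong (r *_) (m∸n+n≡m f≤M) ⟩
    r * M                    ∎

theorem4 : (n r : ℕ) (1≤r : 1 ≤ r) (2r<n : 2 * r < n)
    (δ : ℝ) → δ <ᴿ fromℚ (_/_ (+ 1) (2 * r * n ^ 4) {{2rn⁴≢0 1≤r 2r<n}}) →
    (G : Hypergraph r n) → Intersecting G →
    fromℕ (size G) >ᴿ (fromℕ 1 -ᴿ δ) *ᴿ fromℕ ((n ∸ 1) C (r ∸ 1)) →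
    ∃[ v ] (fromℕ (length (edgesAvoiding G v)) ≤ᴿ δ *ᴿ fromℕ r *ᴿ fromℕ ((n ∸ 1) C (r ∸ 1)))
theorem4 n r 1≤r 2r<n δ (_ , 0<ε₁ , N₁ , δ<) G int (_ , 0<ε₂ , N₂ , near) =
  -- The integer bound `few` does not mention `δ`, so the same `v` serves for every term of `δ` from
  -- `N₂` on.
  v , λ ε 0<ε → N₂ , λ m N₂≤m →
    ℚ.≤-trans (avoiding-bound r M (size G) (length (edgesAvoiding G v)) (seq δ m) few (near′ m N₂≤m))
              (p≤p+ε _ 0<ε)
  where
  open RationalBounds
  M = (n ∸ 1) C (r ∸ 1)
  near′ = λ m N₂≤m → ℚ.≤-trans (p≤p+ε (seq ((fromℕ 1 -ᴿ δ) *ᴿ fromℕ M) m) 0<ε₂) (near m N₂≤m)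
  stable : ∃[ v ] length (edgesAvoiding G v) + r * size G ≤ r * M
  stable = hypergraph-stability n r 1≤r 2r<n G int
    -- A single term of `δ`, late enough for both hypotheses, gives the integer hypothesis.
    (near-maximum (2 * r * n ^ 4) {{2rn⁴≢0 1≤r 2r<n}} M (size G) (seq δ (N₁ ℕ.⊔ N₂))
      (ℚ.≤-trans (p≤p+ε _ 0<ε₁) (δ< _ (m≤m⊔n N₁ N₂))) (near′ _ (m≤n⊔m N₁ N₂)))
  v = proj₁ stable
  few = proj₂ stable
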